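{- Let $k > 2$ and $p > 1$ be integers. If $G$ is a $(k^p+1,1)$-ear graph, then $G$ has (strong) periodicity number $p$ under the $k$-distance operator, i.e. $\rho^k(G) = p$.
   Context: Graphs are simple and undirected; $d_G(u,v)$ denotes geodesic distance (length of a shortest path) in $G$, and $N_G(x)$ the neighborhood of $x$. For $k>1$, the $k$-distance operator $D^k$ sends a graph $G$ to the graph $D^k(G)$ on the same vertex set in which $u,v$ are adjacent if and only if $d_G(u,v)=k$. Set $G_1^k = G$ and $G_t^k = D^k(G_{t-1}^k)$ for $t>1$. The periodicity number $\rho^k(G)$ is $f-1$, where $f>1$ is the least integer such that $G_f^k \cong G_1^k$ (graph isomorphism); if no such $f$ exists, $\rho^k(G)=0$. Two vertices $u,v$ are false twins if $N_G(u)=N_G(v)$ and $u \notin N_G(v)$. An ear graph is a graph $G=(V,E)$ that contains an induced cycle on $|V|-2$ vertices such that two (distinct) vertices $a,b$ of the cycle have false twins $a',b'$ respectively, where $a',b'$ are the two vertices of $G$ not on the cycle. With $n=|V|-2$ and $d=d_G(a,b)$, such a $G$ is called an $(n,d)$-ear graph (or $(n,d)$-ear). -}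

module Defs where

open import Data.Nat using (ℕ; zero; suc; _+_; _∸_; _≤_; _<_)
open import Data.Nat.Properties using (<⇒≤)
open import Data.Fin using (Fin; zero; suc; toℕ; fromℕ; inject₁; opposite)
open import Data.Fin.Properties using (opposite-involutive)
open import Data.Product using (∃; _×_; _,_)
open import Data.Sum using (_⊎_; inj₁; inj₂)
open import Function.Base using (const)
open import Function.Bundles using (_↔_; _⇔_; Inverse; mk↔ₛ′)
open import Function.Definitions using (Injective)
open import Relation.Binary.PropositionalEquality
  using (_≡_; _≢_; refl; sym; trans; cong; subst)
open import Relation.Nullary using (¬_; contradiction)
open import Relation.Unary using (Pred; _≐_; _∈_; _∉_)

record Graph (V : Set) : Set₁ where
  field
    Adj     : V → V → Set
    symm    : ∀ {u v} → Adj u v → Adj v u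
    irrefl  : ∀ {v} → ¬ Adj v v

open Graph public using (Adj)

N : ∀ {V} → Graph V → V → Pred V _
N G x y = Adj G x y

infix 4 _≅_

record _≅_ {V W : Set} (G : Graph V) (H : Graph W) : Set where
  field
    bijection : V ↔ W
    adj⇔      : ∀ u v → Adj G u v ⇔ Adj H (Inverse.to bijection u) (Inverse.to bijection v)

record Path {V : Set} (G : Graph V) (u v : V) (ℓ : ℕ) : Set where
  field
    vertex   : Fin (suc ℓ) → V
    distinct : Injective _≡_ _≡_ vertex
    start    : vertex zero ≡ u
    end      : vertex (fromℕ ℓ) ≡ v
    step     : ∀ (i : Fin ℓ) → Adj G (vertex (inject₁ i)) (vertex (suc i))

-- IsDist G u v m says d_G(u,v) = m.  It is a relation because the distance is
-- undefined (infinite) between vertices of different components.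
IsDist : ∀ {V} → Graph V → V → V → ℕ → Set
IsDist G u v m = Path G u v m × (∀ ℓ → ℓ < m → ¬ Path G u v ℓ)

opposite-inject₁ : ∀ {n} (i : Fin n) → opposite (inject₁ i) ≡ suc (opposite i)
opposite-inject₁ zero    = refl
opposite-inject₁ (suc i) = cong inject₁ (opposite-inject₁ i)

opposite-fromℕ : ∀ n → opposite (fromℕ n) ≡ zero
opposite-fromℕ zero    = refl
opposite-fromℕ (suc n) = cong inject₁ (opposite-fromℕ n)

reverse : ∀ {V} (G : Graph V) {u v ℓ} → Path G u v ℓ → Path G v u ℓ
reverse G {ℓ = ℓ} P = record
  { vertex   = λ i → vertex (opposite i)
  ; distinct = λ {i} {j} eq →
      trans (sym (opposite-involutive i))
        (trans (cong opposite (distinct eq)) (opposite-involutive j))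
  ; start    = end
  ; end      = trans (cong vertex (opposite-fromℕ ℓ)) start
  ; step     = λ i → subst (λ j → Adj G (vertex j) (vertex (inject₁ (opposite i))))
                       (sym (opposite-inject₁ i))
                       (Graph.symm G (step (opposite i)))
  } where open Path P

trivialPath : ∀ {V} (G : Graph V) v → Path G v v 0
trivialPath G v = record
  { vertex   = const v
  ; distinct = λ { {zero} {zero} _ → refl }
  ; start    = refl
  ; end      = refl
  ; step     = λ ()
  }

D : (k : ℕ) → 1 < k → ∀ {V} → Graph V → Graph V
D k 1<k G = record
  { Adj    = λ u v → IsDist G u v k
  ; symm   = λ (P , least) → reverse G P , λ ℓ ℓ<k Q → least ℓ ℓ<k (reverse G Q)
  ; irrefl = λ {v} (_ , least) → least 0 (<⇒≤ 1<k) (trivialPath G v)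
  }

-- seq k 1<k G t is G_t^k, which is meaningful for t ≥ 1; the value at 0 is never used.
seq : (k : ℕ) → 1 < k → ∀ {V} → Graph V → ℕ → Graph V
seq k 1<k G zero          = G
seq k 1<k G (suc zero)    = G
seq k 1<k G (suc (suc t)) = D k 1<k (seq k 1<k G (suc t))

-- PeriodicityNumber k 1<k G r says ρ^k(G) = r.  It is a relation because for a
-- general graph it is not decidable whether a suitable f exists.
data PeriodicityNumber (k : ℕ) (1<k : 1 < k) {V : Set} (G : Graph V) : ℕ → Set where
  periodic : ∀ f → 1 < f
    → seq k 1<k G f ≅ seq k 1<k G 1
    → (∀ g → 1 < g → g < f → ¬ (seq k 1<k G g ≅ seq k 1<k G 1))
    → PeriodicityNumber k 1<k G (f ∸ 1)
  aperiodic :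
      (∀ f → 1 < f → ¬ (seq k 1<k G f ≅ seq k 1<k G 1))
    → PeriodicityNumber k 1<k G 0

FalseTwins : ∀ {V} → Graph V → V → V → Set
FalseTwins G u v = (N G u ≐ N G v) × (u ∉ N G v)

-- j follows i in the cyclic order 0, 1, …, n - 1, 0.
Next : ∀ {n} → Fin n → Fin n → Set
Next {n} i j = (suc (toℕ i) ≡ toℕ j) ⊎ (suc (toℕ i) ≡ n × toℕ j ≡ 0)

record InducedCycle {V : Set} (G : Graph V) (n : ℕ) : Set where
  field
    3≤n      : 3 ≤ n
    vertex   : Fin n → V
    distinct : Injective _≡_ _≡_ vertex
    adj⇔     : ∀ i j → Adj G (vertex i) (vertex j) ⇔ (Next i j ⊎ Next j i)

  OnCycle : Pred V _
  OnCycle v = ∃ λ i → vertex i ≡ v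

-- The condition n = |V| - 2 is expressed by a′, b′ being exactly the vertices
-- outside the cycle; see `order` below.
record Ear {V : Set} (G : Graph V) (n d : ℕ) : Set where
  field
    cycle : InducedCycle G n

  open InducedCycle cycle using (OnCycle)

  field
    a b a′ b′ : V
    a∈cycle   : a ∈ OnCycle
    b∈cycle   : b ∈ OnCycle
    a≢b       : a ≢ b
    a′∉cycle  : a′ ∉ OnCycle
    b′∉cycle  : b′ ∉ OnCycle
    a′≢b′     : a′ ≢ b′
    exhaust   : ∀ v → v ∈ OnCycle ⊎ v ≡ a′ ⊎ v ≡ b′
    twins-a   : FalseTwins G a a′
    twins-b   : FalseTwins G b b′
    dist      : IsDist G a b d

order : ∀ {V} {G : Graph V} {n d} → Ear G n d → V ↔ Fin (2 + n)
order {V} {G} {n} E = mk↔ₛ′ (λ v → index (exhaust v)) from to∘from from∘to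
  where
  open Ear E
  open InducedCycle cycle

  index : ∀ {v} → v ∈ OnCycle ⊎ v ≡ a′ ⊎ v ≡ b′ → Fin (2 + n)
  index (inj₁ (i , _))  = suc (suc i)
  index (inj₂ (inj₁ _)) = zero
  index (inj₂ (inj₂ _)) = suc zero

  from : Fin (2 + n) → V
  from zero          = a′
  from (suc zero)    = b′
  from (suc (suc i)) = vertex i

  from∘index : ∀ {v} (x : v ∈ OnCycle ⊎ v ≡ a′ ⊎ v ≡ b′) → from (index x) ≡ v
  from∘index (inj₁ (_ , eq))   = eq
  from∘index (inj₂ (inj₁ v≡a′)) = sym v≡a′
  from∘index (inj₂ (inj₂ v≡b′)) = sym v≡b′

  from∘to : ∀ v → from (index (exhaust v)) ≡ v
  from∘to v = from∘index (exhaust v)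

  from-injective : ∀ x y → from x ≡ from y → x ≡ y
  from-injective zero          zero          _  = refl
  from-injective zero          (suc zero)    eq = contradiction eq a′≢b′
  from-injective zero          (suc (suc j)) eq = contradiction (j , sym eq) a′∉cycle
  from-injective (suc zero)    zero          eq = contradiction (sym eq) a′≢b′
  from-injective (suc zero)    (suc zero)    _  = refl
  from-injective (suc zero)    (suc (suc j)) eq = contradiction (j , sym eq) b′∉cycle
  from-injective (suc (suc i)) zero          eq = contradiction (i , eq) a′∉cycle
  from-injective (suc (suc i)) (suc zero)    eq = contradiction (i , eq) b′∉cycle
  from-injective (suc (suc i)) (suc (suc j)) eq = cong (λ l → suc (suc l)) (distinct eq)

  to∘from : ∀ x → index (exhaust (from x)) ≡ x
  to∘from x = from-injective _ x (from∘to (from x))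

{-# OPTIONS --safe #-}
-- An (n , 1)-ear is the cycle ℤ/n with two neighbouring vertices doubled: it has a map π to ℤ/n
-- under which u and v are adjacent iff π v − π u ≡ ±1.  When s is invertible mod n, 2 < k and
-- 2 k ≤ n, the operator D k turns the condition π v − π u ≡ ± s into π v − π u ≡ ± k s, since
-- the only pairs of equal π are at distance 0 or 2.  So G_{1+j} is given by s = k ^ j, and
-- k ^ p ≡ −1 mod n gives back G itself after p steps.  For 0 < j < p, false twins in G_{1+j} still
-- have equal π, so two doubled vertices have π-difference 0 or ±1, which is not ± k ^ j:
-- unlike in G, no two pairs of distinct false twins are joined by an edge.
module Submission where

open import Data.Nat as ℕ using (ℕ; zero; suc; _+_; _*_; _^_; _∸_; _≤_; _<_; z≤n; s≤s)
import Data.Nat.Properties as ℕ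
open import Data.Nat.Properties using (<⇒≤)
open import Data.Nat.Divisibility using (>⇒∤)
open import Data.Integer as ℤ using (ℤ; +_; -[1+_]; ∣_∣)
import Data.Integer.Properties as ℤ
open import Data.Integer.DivMod using (n%ℕd<d; a≡a%ℕn+[a/ℕn]*n)
open import Data.Integer.Divisibility.Signed
open import Data.Integer.Tactic.RingSolver using (solve)
open import Data.Fin using (Fin; zero; suc; toℕ; fromℕ; fromℕ<; inject₁)
open import Data.Fin.Properties
  using (toℕ<n; toℕ≤pred[n]; toℕ-injective; toℕ-inject₁; toℕ-fromℕ<)
open import Data.List using ([]; _∷_)
open import Data.Product using (∃; _×_; _,_; proj₁; proj₂)
open import Data.Sum as Sum using (_⊎_; inj₁; inj₂)
open import Function.Base using (_∘_)
open import Function.Bundles using (_⇔_; Inverse; Equivalence; mk⇔)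
open import Function.Construct.Identity using (↔-id)
open import Relation.Binary.PropositionalEquality
open import Relation.Nullary using (¬_; contradiction)
open import Relation.Unary using (_⊆_)
open import Defs

open Equivalence using (to; from)

-- Congruence of integers modulo `n`.

small-multiple : ∀ {n i} → + n ∣ i → ∣ i ∣ < n → i ≡ + 0
small-multiple {n} {i} n∣i ∣i∣<n with ∣ i ∣ in eq | ∣⇒∣ᵤ n∣i
... | zero  | _     = ℤ.∣i∣≡0⇒i≡0 eq
... | suc m | n∣1+m = contradiction n∣1+m (>⇒∤ ∣i∣<n)

∣+m-+n∣≤m⊔n : ∀ m n → ∣ + m ℤ.- + n ∣ ≤ m ℕ.⊔ n
∣+m-+n∣≤m⊔n m n = subst (λ i → ∣ i ∣ ≤ m ℕ.⊔ n) (sym (ℤ.m-n≡m⊖n m n)) (ℤ.∣m⊝n∣≤m⊔n m n)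

∣+m-+n∣< : ∀ {m n o} → m < o → n < o → ∣ + m ℤ.- + n ∣ < o
∣+m-+n∣< {m} {n} m<o n<o = ℕ.≤-<-trans (∣+m-+n∣≤m⊔n m n) (ℕ.⊔-lub m<o n<o)

module Congruence (n : ℕ) where

  infix 4 _≈_

  -- Wrapped in a record so that unification recovers `x` and `y` from the type of a proof; the
  -- difference alone does not determine them.
  record _≈_ (x y : ℤ) : Set where
    constructor mk≈
    field n∣x-y : + n ∣ x ℤ.- y

  -- With `combined`, this turns each deduction about congruences into an identity in ℤ: the caller
  -- supplies the multipliers and the ring solver proves the identity.
  scaled : ∀ {x y w z} c → x ≈ y → w ℤ.- z ≡ c ℤ.* (x ℤ.- y) → w ≈ z
  scaled c (mk≈ p) eq = mk≈ (subst (+ n ∣_) (sym eq) (∣n⇒∣m*n c p))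

  combined : ∀ {x y x′ y′ w z} c d → x ≈ y → x′ ≈ y′ →
    w ℤ.- z ≡ c ℤ.* (x ℤ.- y) ℤ.+ d ℤ.* (x′ ℤ.- y′) → w ≈ z
  combined c d (mk≈ p) (mk≈ q) eq =
    mk≈ (subst (+ n ∣_) (sym eq) (∣m∣n⇒∣m+n (∣n⇒∣m*n c p) (∣n⇒∣m*n d q)))

  ≈-refl : ∀ {x} → x ≈ x
  ≈-refl {x} = mk≈ (divides (+ 0) (ℤ.+-inverseʳ x))

  ≈-reflexive : ∀ {x y} → x ≡ y → x ≈ y
  ≈-reflexive refl = ≈-refl

  ≈-sym : ∀ {x y} → x ≈ y → y ≈ x
  ≈-sym {x} {y} p = scaled (ℤ.- (+ 1)) p (solve (x ∷ y ∷ []))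

  ≈-trans : ∀ {x y z} → x ≈ y → y ≈ z → x ≈ z
  ≈-trans {x} {y} {z} p q = combined (+ 1) (+ 1) p q (solve (x ∷ y ∷ z ∷ []))

  ≈⇒≡ : ∀ {x y} → x ≈ y → ∣ x ℤ.- y ∣ < n → x ≡ y
  ≈⇒≡ {x} {y} (mk≈ p) small = ℤ.i-j≡0⇒i≡j x y (small-multiple p small)

  -- The multipliers come from `x - y = t (x s - y s) + (y - x)(s t - 1)`.
  cancel-unit : ∀ s t x y → s ℤ.* t ≈ + 1 → x ℤ.* s ≈ y ℤ.* s → x ≈ y
  cancel-unit s t x y unit p =
    combined t (y ℤ.- x) p unit (solve (s ∷ t ∷ x ∷ y ∷ []))

  advance : ∀ x s e {y z} → y ≈ x ℤ.+ s → z ≈ y ℤ.+ e ℤ.* s → z ≈ x ℤ.+ (+ 1 ℤ.+ e) ℤ.* s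
  advance x s e {y} {z} p q =
    combined (+ 1) (+ 1) p q (solve (x ∷ y ∷ z ∷ s ∷ e ∷ []))

  retreat : ∀ y s e {x z} → x ≈ y ℤ.+ s → z ≈ y ℤ.+ e ℤ.* s →
    z ≈ x ℤ.+ (ℤ.- (+ 1) ℤ.+ e) ℤ.* s
  retreat y s e {x} {z} p q =
    combined (ℤ.- (+ 1)) (+ 1) p q (solve (x ∷ y ∷ z ∷ s ∷ e ∷ []))

  remaining : ∀ x s e {y z} → y ≈ x ℤ.+ s → z ≈ x ℤ.+ (+ 1 ℤ.+ e) ℤ.* s → z ≈ y ℤ.+ e ℤ.* s
  remaining x s e {y} {z} p q =
    combined (ℤ.- (+ 1)) (+ 1) p q (solve (x ∷ y ∷ z ∷ s ∷ e ∷ []))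

  consecutive : ∀ x s e {y z} → y ≈ x ℤ.+ e ℤ.* s → z ≈ x ℤ.+ (+ 1 ℤ.+ e) ℤ.* s → z ≈ y ℤ.+ s
  consecutive x s e {y} {z} p q =
    combined (ℤ.- (+ 1)) (+ 1) p q (solve (x ∷ y ∷ z ∷ s ∷ e ∷ []))

  backward : ∀ x s e {y} → y ≈ x ℤ.+ (ℤ.- e) ℤ.* s → x ≈ y ℤ.+ e ℤ.* s
  backward x s e {y} p = scaled (ℤ.- (+ 1)) p (solve (x ∷ y ∷ s ∷ e ∷ []))

  offset-zero : ∀ x s {y} → y ≈ x → y ≈ x ℤ.+ + 0 ℤ.* s
  offset-zero x s {y} p = scaled (+ 1) p (solve (x ∷ y ∷ s ∷ []))

  offset-zero⁻¹ : ∀ x s {y} → y ≈ x ℤ.+ + 0 ℤ.* s → y ≈ x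
  offset-zero⁻¹ x s {y} p = scaled (+ 1) p (solve (x ∷ y ∷ s ∷ []))

  same-centre : ∀ x x′ s {w} → w ≈ x ℤ.+ s → w ≈ x′ ℤ.+ s → x ≈ x′
  same-centre x x′ s {w} p q =
    combined (ℤ.- (+ 1)) (+ 1) p q (solve (x ∷ x′ ∷ w ∷ s ∷ []))

  +-congʳ : ∀ {x y} c → x ≈ y → x ℤ.+ c ≈ y ℤ.+ c
  +-congʳ {x} {y} c p = scaled (+ 1) p (solve (x ∷ y ∷ c ∷ []))

  same-offset : ∀ x c d {y} → y ≈ x ℤ.+ c → y ≈ x ℤ.+ d → c ≈ d
  same-offset x c d {y} p q = combined (ℤ.- (+ 1)) (+ 1) p q (solve (x ∷ y ∷ c ∷ d ∷ []))

  opposite-offset : ∀ x c {y} → y ≈ x ℤ.+ (ℤ.- c) → x ≈ y ℤ.+ c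
  opposite-offset x c {y} p = scaled (ℤ.- (+ 1)) p (solve (x ∷ y ∷ c ∷ []))

  -- The closed walk `x`, `w`, `x′`, `v`, `x` goes forward by `s` four times.
  two-neighbours : ∀ x x′ v w s → w ≈ x ℤ.+ s → x′ ≈ w ℤ.+ s → x ≈ v ℤ.+ s → v ≈ x′ ℤ.+ s →
    + 4 ℤ.* s ≈ + 0 ℤ.* s
  two-neighbours x x′ v w s p q r t =
    combined {w = + 4 ℤ.* s} (ℤ.- (+ 1)) (ℤ.- (+ 1))
      (combined {w = x′} {z = x ℤ.+ + 2 ℤ.* s} (+ 1) (+ 1) p q (solve (x ∷ x′ ∷ w ∷ s ∷ [])))
      (combined {w = x} {z = x′ ℤ.+ + 2 ℤ.* s} (+ 1) (+ 1) r t (solve (x ∷ x′ ∷ v ∷ s ∷ [])))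
      (solve (x ∷ x′ ∷ s ∷ []))

  offset-between : ∀ α β x y → β ≈ α ℤ.+ + 1 → x ≈ α ⊎ x ≈ β → y ≈ α ⊎ y ≈ β →
    ∃ λ c → ∣ c ∣ ≤ 1 × y ≈ x ℤ.+ c
  offset-between α β x y β≈α+1 (inj₁ p) (inj₁ q) =
    + 0 , z≤n , combined (ℤ.- (+ 1)) (+ 1) p q (solve (x ∷ y ∷ α ∷ []))
  offset-between α β x y β≈α+1 (inj₁ p) (inj₂ q) =
    + 1 , s≤s z≤n , combined (ℤ.- (+ 1)) (+ 1) p (≈-trans q β≈α+1) (solve (x ∷ y ∷ α ∷ []))
  offset-between α β x y β≈α+1 (inj₂ p) (inj₁ q) =
    ℤ.- (+ 1) , s≤s z≤n , combined (ℤ.- (+ 1)) (+ 1) (≈-trans p β≈α+1) q (solve (x ∷ y ∷ α ∷ []))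
  offset-between α β x y β≈α+1 (inj₂ p) (inj₂ q) =
    + 0 , z≤n , combined (ℤ.- (+ 1)) (+ 1) p q (solve (x ∷ y ∷ β ∷ []))

-- Blow-ups of circulant graphs and their distances.

module Blowup {V : Set} (n : ℕ) (π : V → ℤ)
  (lift : ∀ z → ∃ λ v → Congruence._≈_ n (π v) z) where

  open Congruence n

  Joined : ℤ → V → V → Set
  Joined s u v = (π v ≈ π u ℤ.+ s) ⊎ (π u ≈ π v ℤ.+ s)

  -- The circulant graph on ℤ/n with connection set `± s`, each residue replaced by its fibre under
  -- `π`.
  IsBlowup : Graph V → ℤ → Set
  IsBlowup H s = ∀ u v → Adj H u v ⇔ Joined s u v

  -- Every edge moves `π` by `s` or `- s`, so `e` counts forward steps minus backward ones. Walks
  -- rather than paths are used so that the induction can drop the first vertex without carrying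
  -- distinctness.
  displacement : ∀ {H s} → IsBlowup H s → ∀ ℓ (f : Fin (suc ℓ) → V) →
    (∀ i → Adj H (f (inject₁ i)) (f (suc i))) →
    ∃ λ e → ∣ e ∣ ≤ ℓ × π (f (fromℕ ℓ)) ≈ π (f zero) ℤ.+ e ℤ.* s
  displacement {H} {s} H≈s zero f step = + 0 , z≤n , offset-zero (π (f zero)) s ≈-refl
  displacement {H} {s} H≈s (suc ℓ) f step
    with displacement {H} {s} H≈s ℓ (f ∘ suc) (step ∘ suc) | to (H≈s _ _) (step zero)
  ... | e , ∣e∣≤ℓ , eq | inj₁ forth =
    + 1 ℤ.+ e , ℕ.≤-trans (ℤ.∣i+j∣≤∣i∣+∣j∣ (+ 1) e) (s≤s ∣e∣≤ℓ) ,
    advance (π (f zero)) s e forth eq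
  ... | e , ∣e∣≤ℓ , eq | inj₂ back =
    ℤ.- (+ 1) ℤ.+ e , ℕ.≤-trans (ℤ.∣i+j∣≤∣i∣+∣j∣ (ℤ.- (+ 1)) e) (s≤s ∣e∣≤ℓ) ,
    retreat (π (f (suc zero))) s e back eq

  path-displacement : ∀ {H s u v ℓ} → IsBlowup H s → Path H u v ℓ →
    ∃ λ e → ∣ e ∣ ≤ ℓ × π v ≈ π u ℤ.+ e ℤ.* s
  path-displacement {H} {s} H≈s P with displacement {H} H≈s _ (Path.vertex P) (Path.step P)
  ... | e , ∣e∣≤ℓ , eq =
    e , ∣e∣≤ℓ , subst₂ (λ x y → π y ≈ π x ℤ.+ e ℤ.* s) (Path.start P) (Path.end P) eq

  -- Only the interior vertices are lifts. The last one is `v` itself, since a lift of its residue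
  -- could be another vertex of the same fibre.
  arc : ℤ → ∀ m → V → V → Fin (suc (suc m)) → V
  arc s zero    u v zero    = u
  arc s zero    u v (suc i) = v
  arc s (suc m) u v zero    = u
  arc s (suc m) u v (suc i) = arc s m (proj₁ (lift (π u ℤ.+ s))) v i

  arc-start : ∀ s m u v → arc s m u v zero ≡ u
  arc-start s zero    u v = refl
  arc-start s (suc m) u v = refl

  arc-end : ∀ s m u v → arc s m u v (fromℕ (suc m)) ≡ v
  arc-end s zero    u v = refl
  arc-end s (suc m) u v = arc-end s m _ v

  π-arc : ∀ s m u v → π v ≈ π u ℤ.+ + suc m ℤ.* s →
    ∀ i → π (arc s m u v i) ≈ π u ℤ.+ + toℕ i ℤ.* s
  π-arc s zero    u v eq zero       = offset-zero (π u) s ≈-refl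
  π-arc s zero    u v eq (suc zero) = eq
  π-arc s (suc m) u v eq zero       = offset-zero (π u) s ≈-refl
  π-arc s (suc m) u v eq (suc i)    =
    let w , w≈ = lift (π u ℤ.+ s) in
    advance (π u) s (+ toℕ i) w≈ (π-arc s m w v (remaining (π u) s (+ suc m) w≈ eq) i)

  module _ {s t : ℤ} (unit : s ℤ.* t ≈ + 1) where

    -- The residues `π u + i s` with `0 ≤ i < n` are distinct because `s` is a unit, so the arc
    -- repeats no vertex.
    arc-path : ∀ {H} → IsBlowup H s → ∀ {m u v} → suc m < n →
      π v ≈ π u ℤ.+ + suc m ℤ.* s → Path H u v (suc m)
    arc-path H≈s {m} {u} {v} 1+m<n eq = record
      { vertex   = arc s m u v
      ; distinct = λ {i} {j} same → toℕ-injective (ℤ.+-injective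
          (≈⇒≡ (cancel-unit s t _ _ unit (same-offset (π u) _ _ (π-arc s m u v eq i)
                 (subst (λ w → π w ≈ π u ℤ.+ + toℕ j ℤ.* s) (sym same) (π-arc s m u v eq j))))
               (∣+m-+n∣< (bound i) (bound j))))
      ; start    = arc-start s m u v
      ; end      = arc-end s m u v
      ; step     = λ i → from (H≈s _ _) (inj₁ (consecutive (π u) s (+ toℕ i)
          (subst (λ j → π (arc s m u v (inject₁ i)) ≈ π u ℤ.+ + j ℤ.* s) (toℕ-inject₁ i)
            (π-arc s m u v eq (inject₁ i)))
          (π-arc s m u v eq (suc i))))
      }
      where
      bound : (i : Fin (suc (suc m))) → toℕ i < n
      bound i = ℕ.≤-<-trans (toℕ≤pred[n] i) 1+m<n

    -- Any lift of `π u + s` is a common neighbour.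
    twin-path : ∀ {H} → IsBlowup H s → ∀ {u v} → π v ≈ π u → u ≢ v → Path H u v 2
    twin-path {H} H≈s {u} {v} v≈u u≢v = record
      { vertex   = vertex
      ; distinct = distinct _ _
      ; start    = refl
      ; end      = refl
      ; step     = λ { zero → uw ; (suc zero) → wv }
      }
      where
      w = proj₁ (lift (π u ℤ.+ s))
      w≈ = proj₂ (lift (π u ℤ.+ s))

      uw : Adj H u w
      uw = from (H≈s u w) (inj₁ w≈)

      wv : Adj H w v
      wv = from (H≈s w v) (inj₂ (≈-trans w≈ (+-congʳ s (≈-sym v≈u))))

      loop : ∀ {x y} → Adj H x y → x ≢ y
      loop xy refl = Graph.irrefl H xy

      vertex : Fin 3 → V
      vertex zero             = u
      vertex (suc zero)       = w
      vertex (suc (suc zero)) = v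

      distinct : ∀ i j → vertex i ≡ vertex j → i ≡ j
      distinct zero             zero             _  = refl
      distinct zero             (suc zero)       eq = contradiction eq (loop uw)
      distinct zero             (suc (suc zero)) eq = contradiction eq u≢v
      distinct (suc zero)       zero             eq = contradiction (sym eq) (loop uw)
      distinct (suc zero)       (suc zero)       _  = refl
      distinct (suc zero)       (suc (suc zero)) eq = contradiction eq (loop wv)
      distinct (suc (suc zero)) zero             eq = contradiction (sym eq) u≢v
      distinct (suc (suc zero)) (suc zero)       eq = contradiction (sym eq) (loop wv)
      distinct (suc (suc zero)) (suc (suc zero)) _  = refl

    module _ {k : ℕ} (2<k : 2 < k) (1<k : 1 < k) (2k≤n : k + k ≤ n) where

      k<n : k < n
      k<n = ℕ.<-≤-trans (ℕ.m<m+n k (ℕ.<-trans (s≤s z≤n) 1<k)) 2k≤n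

      arc-path′ : ∀ {H} → IsBlowup H s → ∀ {m u v} → 0 < m → m ≤ k →
        π v ≈ π u ℤ.+ + m ℤ.* s → Path H u v m
      arc-path′ H≈s {suc m} _ m≤k = arc-path H≈s (ℕ.≤-<-trans m≤k k<n)

      -- A path of length `ℓ < k` would have a displacement `e ≈ k` with `∣ e ∣ ≤ ℓ`. Then
      -- `∣ e - k ∣ < 2 k ≤ n` forces `e = k`, which is too large.
      arc-dist : ∀ {H} → IsBlowup H s → ∀ {u v} →
        π v ≈ π u ℤ.+ + k ℤ.* s → IsDist H u v k
      arc-dist {H} H≈s {u} {v} eq =
        arc-path′ H≈s (ℕ.<-trans (s≤s z≤n) 1<k) ℕ.≤-refl eq , least
        where
        least : ∀ ℓ → ℓ < k → ¬ Path H u v ℓ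
        least ℓ ℓ<k P with path-displacement H≈s P
        ... | e , ∣e∣≤ℓ , eq′ = ℕ.<⇒≱ ℓ<k (subst (λ i → ∣ i ∣ ≤ ℓ) e≡k ∣e∣≤ℓ)
          where
          e≡k : e ≡ + k
          e≡k = ≈⇒≡ (cancel-unit s t e (+ k) unit (same-offset (π u) (e ℤ.* s) (+ k ℤ.* s) eq′ eq))
            (ℕ.≤-<-trans (ℤ.∣i-j∣≤∣i∣+∣j∣ e (+ k))
              (ℕ.<-≤-trans (ℕ.+-monoˡ-< k (ℕ.≤-<-trans ∣e∣≤ℓ ℓ<k)) 2k≤n))

      dist-reverse : ∀ {H : Graph V} {u v} → IsDist H u v k → IsDist H v u k
      dist-reverse {H} = Graph.symm (D k 1<k H)

      arc-maximal : ∀ {H} → IsBlowup H s → ∀ {u v m} → IsDist H u v k → 0 < m → m ≤ k →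
        π v ≈ π u ℤ.+ + m ℤ.* s → π v ≈ π u ℤ.+ + k ℤ.* s
      arc-maximal H≈s {m = m} (_ , least) 0<m m≤k eq with ℕ.m≤n⇒m<n∨m≡n m≤k
      ... | inj₁ m<k  = contradiction (arc-path′ H≈s 0<m m≤k eq) (least m m<k)
      ... | inj₂ refl = eq

      D-blowup : ∀ {H} → IsBlowup H s → IsBlowup (D k 1<k H) (+ k ℤ.* s)
      D-blowup {H} H≈s u v = mk⇔ forth
        λ { (inj₁ eq) → arc-dist H≈s eq
          ; (inj₂ eq) → dist-reverse {H} (arc-dist H≈s eq) }
        where
        forth : IsDist H u v k → Joined (+ k ℤ.* s) u v
        forth dist@(P , least) with path-displacement H≈s P
        -- Zero displacement keeps `u` and `v` in one fibre, hence at distance 0 or at most 2; both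
        -- are below `k`.
        ... | + zero    , _   , eq =
          contradiction (twin-path H≈s (offset-zero⁻¹ (π u) s eq) u≢v) (least 2 2<k)
          where
          u≢v : u ≢ v
          u≢v refl = least 0 (ℕ.<-trans (s≤s z≤n) 1<k) (trivialPath H u)
        -- A nonzero displacement shorter than `k` would give an arc shorter than the distance, so
        -- its absolute value is exactly `k`. The negative case is read from `v` to `u`.
        ... | + suc m   , m≤k , eq = inj₁ (arc-maximal H≈s dist (s≤s z≤n) m≤k eq)
        ... | -[1+ m ]  , m≤k , eq =
          inj₂ (arc-maximal H≈s (dist-reverse {H} dist) (s≤s z≤n) m≤k (backward (π u) s (+ suc m) eq))

    -- Neighbours of `x` on both sides, at `π x + s` and `π x - s`, are also neighbours of `x′`. If
    -- either lies on the same side of `x′` as of `x`, the projections agree; if both change sides,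
    -- then `4 s ≈ 0`, so `4 ≈ 0` although `4 < n`.
    twins-same-π : ∀ {H} → IsBlowup H s → 4 < n → ∀ {x x′} → N H x ⊆ N H x′ → π x ≈ π x′
    twins-same-π H≈s 4<n {x} {x′} N⊆N′
      with lift (π x ℤ.+ s) | lift (π x ℤ.+ (ℤ.- s))
    ... | w , w≈ | v , v≈
      with to (H≈s x′ w) (N⊆N′ (from (H≈s x w) (inj₁ w≈)))
         | to (H≈s x′ v) (N⊆N′ (from (H≈s x v) (inj₂ (opposite-offset (π x) s v≈))))
    ... | inj₁ w≈x′+s | _           = same-centre (π x) (π x′) s w≈ w≈x′+s
    ... | inj₂ _      | inj₂ x′≈v+s = ≈-trans (opposite-offset (π x) s v≈) (≈-sym x′≈v+s)
    ... | inj₂ x′≈w+s | inj₁ v≈x′+s =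
      contradiction
        (≈⇒≡ (cancel-unit s t (+ 4) (+ 0) unit
               (two-neighbours (π x) (π x′) (π v) (π w) s w≈ x′≈w+s (opposite-offset (π x) s v≈) v≈x′+s)) 4<n)
        λ ()

-- Projection of an ear graph onto its cycle.

module EarProjection {V : Set} {G : Graph V} {n d : ℕ} (E : Ear G n d) where

  open Ear E
  open InducedCycle cycle
  open Congruence n

  index : ∀ {v} → OnCycle v ⊎ v ≡ a′ ⊎ v ≡ b′ → Fin n
  index (inj₁ (i , _))  = i
  index (inj₂ (inj₁ _)) = proj₁ a∈cycle
  index (inj₂ (inj₂ _)) = proj₁ b∈cycle

  ρ : V → Fin n
  ρ v = index (exhaust v)

  π : V → ℤ
  π v = + toℕ (ρ v)

  ρ-vertex : ∀ i → ρ (vertex i) ≡ i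
  ρ-vertex i with exhaust (vertex i)
  ... | inj₁ (j , eq)  = distinct eq
  ... | inj₂ (inj₁ eq) = contradiction (i , eq) a′∉cycle
  ... | inj₂ (inj₂ eq) = contradiction (i , eq) b′∉cycle

  π-onCycle : ∀ {v} (v∈ : OnCycle v) → π v ≡ + toℕ (proj₁ v∈)
  π-onCycle (i , refl) = cong (+_ ∘ toℕ) (ρ-vertex i)

  lift : ∀ z → ∃ λ v → π v ≈ z
  lift z = vertex i , mk≈ (divides (ℤ.- (z ℤ./ℕ n)) (begin
    π (vertex i) ℤ.- z                       ≡⟨ cong (λ j → + toℕ j ℤ.- z) (ρ-vertex i) ⟩
    + toℕ i ℤ.- z                            ≡⟨ cong (λ j → + j ℤ.- z) (toℕ-fromℕ< _) ⟩
    r ℤ.- z                                  ≡⟨ cong (λ x → r ℤ.- x) (a≡a%ℕn+[a/ℕn]*n z n) ⟩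
    r ℤ.- (r ℤ.+ (z ℤ./ℕ n) ℤ.* + n)         ≡⟨ difference r (z ℤ./ℕ n) (+ n) ⟩
    (ℤ.- (z ℤ./ℕ n)) ℤ.* + n                 ∎))
    where
    open ≡-Reasoning
    instance
      n≢0 : ℕ.NonZero n
      n≢0 = ℕ.>-nonZero (ℕ.≤-trans (s≤s z≤n) 3≤n)
    i = fromℕ< (n%ℕd<d z n)
    r = + (z ℤ.%ℕ n)
    difference : ∀ r q m → r ℤ.- (r ℤ.+ q ℤ.* m) ≡ (ℤ.- q) ℤ.* m
    difference r q m = solve (r ∷ q ∷ m ∷ [])

  open Blowup n π lift using (Joined; IsBlowup)

  n≈0 : + n ≈ + 0
  n≈0 = mk≈ (divides (+ 1) (trans (ℤ.+-identityʳ (+ n)) (sym (ℤ.*-identityˡ (+ n)))))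

  next⇒offset : ∀ {i j : Fin n} → Next i j → + toℕ j ≈ + toℕ i ℤ.+ + 1
  next⇒offset {i} {j} (inj₁ 1+i≡j) =
    ≈-reflexive (cong +_ (trans (sym 1+i≡j) (ℕ.+-comm 1 (toℕ i))))
  next⇒offset {i} {j} (inj₂ (1+i≡n , j≡0)) =
    ≈-trans (≈-reflexive (cong +_ j≡0))
      (≈-trans (≈-sym n≈0) (≈-reflexive (cong +_ (trans (sym 1+i≡n) (ℕ.+-comm 1 (toℕ i))))))

  offset⇒next : ∀ {i j : Fin n} → + toℕ j ≈ + toℕ i ℤ.+ + 1 → Next i j
  -- The successor `1 + i` is a reduced residue unless `i` is the last index, where it equals
  -- `n ≈ 0` and the cycle wraps around.
  offset⇒next {i} {j} eq with ℕ.m≤n⇒m<n∨m≡n (toℕ<n i)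
  ... | inj₁ 1+i<n = inj₁ (sym (ℤ.+-injective (≈⇒≡ j≈1+i (∣+m-+n∣< (toℕ<n j) 1+i<n))))
    where
    j≈1+i : + toℕ j ≈ + suc (toℕ i)
    j≈1+i = ≈-trans eq (≈-reflexive (cong +_ (ℕ.+-comm (toℕ i) 1)))
  ... | inj₂ 1+i≡n = inj₂ (1+i≡n , ℤ.+-injective (≈⇒≡ j≈0
          (∣+m-+n∣< (toℕ<n j) (ℕ.≤-trans (s≤s z≤n) 3≤n))))
    where
    j≈0 : + toℕ j ≈ + 0
    j≈0 = ≈-trans eq
      (≈-trans (≈-reflexive (cong +_ (trans (ℕ.+-comm (toℕ i) 1) 1+i≡n))) n≈0)

  retract⇔ : ∀ {v} (v? : OnCycle v ⊎ v ≡ a′ ⊎ v ≡ b′) w →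
    Adj G v w ⇔ Adj G (vertex (index v?)) w
  retract⇔ (inj₁ (i , refl)) w = mk⇔ (λ p → p) (λ p → p)
  retract⇔ (inj₂ (inj₁ refl)) w = subst (λ x → Adj G a′ w ⇔ Adj G x w) (sym (proj₂ a∈cycle))
    (mk⇔ (proj₂ (proj₁ twins-a)) (proj₁ (proj₁ twins-a)))
  retract⇔ (inj₂ (inj₂ refl)) w = subst (λ x → Adj G b′ w ⇔ Adj G x w) (sym (proj₂ b∈cycle))
    (mk⇔ (proj₂ (proj₁ twins-b)) (proj₁ (proj₁ twins-b)))

  ear-blowup : IsBlowup G (+ 1)
  ear-blowup u v = mk⇔
    -- `retract⇔` moves only the first endpoint onto the cycle, so the second is moved between two
    -- uses of symmetry.
    (λ uv → Sum.map next⇒offset next⇒offset (to (adj⇔ (ρ u) (ρ v))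
      (Graph.symm G (to (v⇔ρv _) (Graph.symm G (to (u⇔ρu v) uv))))))
    (λ joined → from (u⇔ρu v) (Graph.symm G (from (v⇔ρv _) (Graph.symm G
      (from (adj⇔ (ρ u) (ρ v)) (Sum.map offset⇒next offset⇒next joined))))))
    where
    u⇔ρu = retract⇔ (exhaust u)
    v⇔ρv = retract⇔ (exhaust v)

  -- `π` is injective modulo `n` on the cycle, so one of the two vertices is `a′` or `b′`.
  doubled : ∀ {x x′} → x ≢ x′ → π x ≈ π x′ → π x ≈ π a ⊎ π x ≈ π b
  doubled {x} {x′} x≢x′ x≈x′ = go (exhaust x) (exhaust x′) x≈x′
    where
    a≡ : ∀ {i} → i ≡ + toℕ (proj₁ a∈cycle) → i ≈ π a
    a≡ eq = ≈-reflexive (trans eq (sym (π-onCycle a∈cycle)))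
    b≡ : ∀ {i} → i ≡ + toℕ (proj₁ b∈cycle) → i ≈ π b
    b≡ eq = ≈-reflexive (trans eq (sym (π-onCycle b∈cycle)))
    go : (x? : OnCycle x ⊎ x ≡ a′ ⊎ x ≡ b′) (x′? : OnCycle x′ ⊎ x′ ≡ a′ ⊎ x′ ≡ b′) →
      + toℕ (index x?) ≈ + toℕ (index x′?) →
      + toℕ (index x?) ≈ π a ⊎ + toℕ (index x?) ≈ π b
    go (inj₂ (inj₁ _)) _ _ = inj₁ (a≡ refl)
    go (inj₂ (inj₂ _)) _ _ = inj₂ (b≡ refl)
    go _ (inj₂ (inj₁ _)) eq = inj₁ (≈-trans eq (a≡ refl))
    go _ (inj₂ (inj₂ _)) eq = inj₂ (≈-trans eq (b≡ refl))
    go (inj₁ (i , i↦x)) (inj₁ (j , j↦x′)) eq =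
      contradiction (trans (sym i↦x) (trans (cong vertex i≡j) j↦x′)) x≢x′
      where
      i≡j : i ≡ j
      i≡j = toℕ-injective (ℤ.+-injective (≈⇒≡ eq (∣+m-+n∣< (toℕ<n i) (toℕ<n j))))

-- Periodicity of ears over the cycle of length `k ^ p + 1`.

large≢small : ∀ {m c} → 1 < m → ∣ c ∣ ≤ 1 → + m ≢ c
large≢small 1<m ∣c∣≤1 refl = ℕ.<⇒≱ 1<m ∣c∣≤1

module Periodicity {k p : ℕ} (2<k : 2 < k) (1<p : 1 < p)
  {V : Set} {G : Graph V} (E : Ear G (k ^ p + 1) 1) where

  n : ℕ
  n = k ^ p + 1

  1<k : 1 < k
  1<k = <⇒≤ 2<k

  instance
    k≢0 : ℕ.NonZero k
    k≢0 = ℕ.>-nonZero (ℕ.<-trans (s≤s z≤n) 1<k)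

  open Ear E
  open EarProjection E
  open Congruence n
  open Blowup n π lift

  2k≤n : k + k ≤ n
  2k≤n = begin
    k + k          ≡⟨ cong (λ m → k + m) (ℕ.+-identityʳ k) ⟨
    2 * k          ≤⟨ ℕ.*-monoˡ-≤ k 1<k ⟩
    k * k          ≡⟨ cong (k *_) (ℕ.*-identityʳ k) ⟨
    k ^ 2          ≤⟨ ℕ.^-monoʳ-≤ k 1<p ⟩
    k ^ p          ≤⟨ ℕ.m≤m+n (k ^ p) 1 ⟩
    n              ∎
    where open ℕ.≤-Reasoning

  4<n : 4 < n
  4<n = ℕ.≤-trans (ℕ.<⇒≤ (ℕ.+-mono-≤ 2<k 2<k)) 2k≤n

  -- The difference of the two sides computes to `+ n`.
  kᵖ≈-1 : + (k ^ p) ≈ ℤ.- (+ 1)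
  kᵖ≈-1 = mk≈ ∣-refl

  -- The inverse comes from splitting `k ^ p ≈ -1` as `k ^ j * k ^ (p ∸ j)`.
  power-unit : ∀ {j} → j ≤ p → + (k ^ j) ℤ.* (ℤ.- (+ (k ^ (p ∸ j)))) ≈ + 1
  power-unit {j} j≤p = scaled (ℤ.- (+ 1)) kᵖ≈-1 (trans
    (rearrange (+ (k ^ j)) (+ (k ^ (p ∸ j))))
    (cong (λ x → ℤ.- (+ 1) ℤ.* (x ℤ.- (ℤ.- (+ 1)))) (trans (sym (ℤ.pos-* (k ^ j) (k ^ (p ∸ j))))
      (cong +_ (trans (sym (ℕ.^-distribˡ-+-* k j (p ∸ j))) (cong (k ^_) (ℕ.m+[n∸m]≡n j≤p)))))))
    where
    rearrange : ∀ x y → x ℤ.* (ℤ.- y) ℤ.- (+ 1) ≡ ℤ.- (+ 1) ℤ.* (x ℤ.* y ℤ.- (ℤ.- (+ 1)))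
    rearrange x y = solve (x ∷ y ∷ [])

  seq-blowup : ∀ j → j ≤ p → IsBlowup (seq k 1<k G (suc j)) (+ (k ^ j))
  seq-blowup zero    _    = ear-blowup
  seq-blowup (suc j) 1+j≤p =
    subst (IsBlowup (seq k 1<k G (suc (suc j)))) (sym (ℤ.pos-* k (k ^ j)))
      (D-blowup (power-unit j≤p) 2<k 1<k 2k≤n (seq-blowup j j≤p))
    where
    j≤p = ℕ.<⇒≤ 1+j≤p

  shift-kᵖ : ∀ {x y} → y ≈ x ℤ.+ + (k ^ p) → x ≈ y ℤ.+ + 1
  shift-kᵖ {x} {y} eq = combined (ℤ.- (+ 1)) (ℤ.- (+ 1)) eq kᵖ≈-1 (rearrange x y (+ (k ^ p)))
    where
    rearrange : ∀ x y m → x ℤ.- (y ℤ.+ + 1) ≡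
      (ℤ.- (+ 1)) ℤ.* (y ℤ.- (x ℤ.+ m)) ℤ.+ (ℤ.- (+ 1)) ℤ.* (m ℤ.- (ℤ.- (+ 1)))
    rearrange x y m = solve (x ∷ y ∷ m ∷ [])

  shift-kᵖ⁻¹ : ∀ {x y} → x ≈ y ℤ.+ + 1 → y ≈ x ℤ.+ + (k ^ p)
  shift-kᵖ⁻¹ {x} {y} eq = combined (ℤ.- (+ 1)) (ℤ.- (+ 1)) eq kᵖ≈-1 (rearrange x y (+ (k ^ p)))
    where
    rearrange : ∀ x y m → y ℤ.- (x ℤ.+ m) ≡
      (ℤ.- (+ 1)) ℤ.* (x ℤ.- (y ℤ.+ + 1)) ℤ.+ (ℤ.- (+ 1)) ℤ.* (m ℤ.- (ℤ.- (+ 1)))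
    rearrange x y m = solve (x ∷ y ∷ m ∷ [])

  returns : seq k 1<k G (suc p) ≅ G
  returns = record
    -- Steps `± k ^ p` and `± 1` give the same edges with the two orientations exchanged, so the
    -- identity map is an isomorphism.
    { bijection = ↔-id V
    ; adj⇔      = λ u v → mk⇔
        (λ uv → from (ear-blowup u v)
          (Sum.swap (Sum.map shift-kᵖ shift-kᵖ (to (seq-blowup p ℕ.≤-refl u v) uv))))
        (λ uv → from (seq-blowup p ℕ.≤-refl u v)
          (Sum.map shift-kᵖ⁻¹ shift-kᵖ⁻¹ (Sum.swap (to (ear-blowup u v) uv))))
    }

  a-b : Adj G a b
  a-b = subst₂ (Adj G) (Path.start P) (Path.end P) (Path.step P zero)
    where P = proj₁ dist

  doubled-offset : ∀ {x y} → x ≈ π a ⊎ x ≈ π b → y ≈ π a ⊎ y ≈ π b →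
    ∃ λ c → ∣ c ∣ ≤ 1 × y ≈ x ℤ.+ c
  doubled-offset {x} {y} p q with to (ear-blowup a b) a-b
  ... | inj₁ b≈a+1 = offset-between (π a) (π b) x y b≈a+1 p q
  ... | inj₂ a≈b+1 = offset-between (π b) (π a) x y a≈b+1 (Sum.swap p) (Sum.swap q)

  -- Doubled positions differ by some `c` with `∣ c ∣ ≤ 1`. Since `∣ m - c ∣ < k ^ p + 1`,
  -- congruence of `m` and `c` would make them equal.
  doubled-apart : ∀ {m x y} → 1 < m → m < k ^ p → x ≈ π a ⊎ x ≈ π b → y ≈ π a ⊎ y ≈ π b →
    ¬ (y ≈ x ℤ.+ + m)
  doubled-apart {m} {x} 1<m m<kᵖ p q eq with doubled-offset p q
  ... | c , ∣c∣≤1 , eq′ = large≢small 1<m ∣c∣≤1 (≈⇒≡ (same-offset x (+ m) c eq eq′)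
    (ℕ.≤-<-trans (ℤ.∣i-j∣≤∣i∣+∣j∣ (+ m) c) (ℕ.+-mono-<-≤ m<kᵖ ∣c∣≤1)))

  -- An isomorphism would pull the adjacent vertices `a`, `b` and their twins back to `H`. The
  -- preimages of `a` and `b` would then sit at doubled positions and yet be joined by a step
  -- `± k ^ suc j`.
  not-before : ∀ j → suc j < p → ¬ (seq k 1<k G (suc (suc j)) ≅ G)
  not-before j 1+j<p iso = apart (to (H-blowup x y) xy)
    where
    open _≅_ iso renaming (adj⇔ to iso⇔)
    open Inverse bijection renaming (to to φ; from to ψ) using (strictlyInverseˡ)

    H : Graph V
    H = seq k 1<k G (suc (suc j))

    H-blowup : IsBlowup H (+ (k ^ suc j))
    H-blowup = seq-blowup (suc j) (ℕ.<⇒≤ 1+j<p)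

    x = ψ a
    y = ψ b

    pulled-back : ∀ {c c′} → N G c ⊆ N G c′ → N H (ψ c) ⊆ N H (ψ c′)
    pulled-back {c} {c′} c⊆c′ {w} cw = from (iso⇔ (ψ c′) w)
      (subst (λ v → Adj G v (φ w)) (sym (strictlyInverseˡ c′))
        (c⊆c′ (subst (λ v → Adj G v (φ w)) (strictlyInverseˡ c) (to (iso⇔ (ψ c) w) cw))))

    still-doubled : ∀ {c c′} → c ≢ c′ → N G c ⊆ N G c′ → π (ψ c) ≈ π a ⊎ π (ψ c) ≈ π b
    still-doubled {c} {c′} c≢c′ c⊆c′ = doubled
      (λ eq → c≢c′ (trans (sym (strictlyInverseˡ c)) (trans (cong φ eq) (strictlyInverseˡ c′))))
      (twins-same-π {+ (k ^ suc j)} (power-unit (ℕ.<⇒≤ 1+j<p)) {H} H-blowup 4<n (pulled-back c⊆c′))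

    x-doubled : π x ≈ π a ⊎ π x ≈ π b
    x-doubled = still-doubled (λ { refl → a′∉cycle a∈cycle }) (proj₁ (proj₁ twins-a))

    y-doubled : π y ≈ π a ⊎ π y ≈ π b
    y-doubled = still-doubled (λ { refl → b′∉cycle b∈cycle }) (proj₁ (proj₁ twins-b))

    xy : Adj H x y
    xy = from (iso⇔ x y)
      (subst₂ (Adj G) (sym (strictlyInverseˡ a)) (sym (strictlyInverseˡ b)) a-b)

    1<m : 1 < k ^ suc j
    1<m = ℕ.^-monoʳ-< k 1<k {0} {suc j} (s≤s z≤n)

    m<kᵖ : k ^ suc j < k ^ p
    m<kᵖ = ℕ.^-monoʳ-< k 1<k 1+j<p

    apart : ¬ Joined (+ (k ^ suc j)) x y
    apart (inj₁ eq) = doubled-apart 1<m m<kᵖ x-doubled y-doubled eq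
    apart (inj₂ eq) = doubled-apart 1<m m<kᵖ y-doubled x-doubled eq

theorem2 : (k p : ℕ) (2<k : 2 < k) → 1 < p → (V : Set) (G : Graph V) →
    Ear G (k ^ p + 1) 1 → PeriodicityNumber k (<⇒≤ 2<k) G p
-- The sequence starts at index 1, so `p` applications of `D k` end at `f = suc p`, and `f ∸ 1`
-- computes to `p`.
theorem2 k p 2<k 1<p V G E = periodic (suc p) (s≤s (ℕ.<⇒≤ 1<p)) returns earlier
  where
  open Periodicity 2<k 1<p E

  earlier : ∀ g → 1 < g → g < suc p → ¬ (seq k 1<k G g ≅ seq k 1<k G 1)
  earlier (suc zero)    (s≤s ()) _
  earlier (suc (suc j)) _ (s≤s 1+j<p) = not-before j 1+j<p
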